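{- Let $\mathbf{I}$ be the $2\times 2$ identity matrix and $$\mathbf{L}=\begin{pmatrix}1&0\\ 1&1\end{pmatrix},\qquad \mathbf{R}=\begin{pmatrix}1&1\\ 0&1\end{pmatrix},$$ and let $\mathcal{M}$ be the set of all finite products of $\mathbf{L}$ and $\mathbf{R}$. (1) For positive integers $m,n$, consider the following algorithm. Initially set $(x\ \ y):=(m\ \ n)$ and $\mathbf{D}:=\mathbf{I}$. While $x\neq y$: if $y<x$, simultaneously replace $(x\ \ y)$ by $(x\ \ y)\mathbf{L}^{ -1}$ and $\mathbf{D}$ by $\mathbf{L}\mathbf{D}$; if $x<y$, simultaneously replace $(x\ \ y)$ by $(x\ \ y)\mathbf{R}^{ -1}$ and $\mathbf{D}$ by $\mathbf{R}\mathbf{D}$. This algorithm terminates, and the function that maps the positive rational $\frac{m}{n}$ to the final matrix $\mathbf{D}$ is a well-defined bijection from the positive rationals to $\mathcal{M}$. Its inverse is the function that maps $\mathbf{D}\in\mathcal{M}$ to the positive rational $\frac{p}{q}$, where $(p\ \ q)=(1\ \ 1)\,\mathbf{D}$. Specifically, on termination $(1\ \ 1)\,\mathbf{D}=\left(\frac{m}{\gcd(m,n)}\ \ \frac{n}{\gcd(m,n)}\right)$. (2) For positive integers $m,n$, consider the transposed algorithm. Initially set $\begin{pmatrix}x\\ y\end{pmatrix}:=\begin{pmatrix}m\\ n\end{pmatrix}$ and $\mathbf{D}:=\mathbf{I}$. While $x\neq y$: if $y<x$, simultaneously replace $\begin{pmatrix}x\\ y\end{pmatrix}$ by $\mathbf{R}^{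 -1}\begin{pmatrix}x\\ y\end{pmatrix}$ and $\mathbf{D}$ by $\mathbf{D}\mathbf{R}$; if $x<y$, simultaneously replace $\begin{pmatrix}x\\ y\end{pmatrix}$ by $\mathbf{L}^{ -1}\begin{pmatrix}x\\ y\end{pmatrix}$ and $\mathbf{D}$ by $\mathbf{D}\mathbf{L}$. This algorithm terminates, and the function that maps the positive rational $\frac{m}{n}$ to the final matrix $\mathbf{D}$ is a well-defined bijection from the positive rationals to $\mathcal{M}$. Its inverse is the function that maps $\mathbf{D}\in\mathcal{M}$ to the positive rational $\frac{p}{q}$, where $\begin{pmatrix}p\\ q\end{pmatrix}=\mathbf{D}\begin{pmatrix}1\\ 1\end{pmatrix}$.
   Context: The finite products of $\mathbf{L}$ and $\mathbf{R}$ include the empty product, which is the identity matrix $\mathbf{I}$. "Finite products" means the set of matrices so obtained. -}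

module Defs where

open import Data.Integer.Base using (ℤ; +_; 0ℤ; 1ℤ; -1ℤ; _<_)
import Data.Integer.Base as ℤ
open import Data.List.Base as List using (List)
open import Data.List.Relation.Unary.All using (All)
open import Data.Nat.Base as ℕ using (ℕ; NonZero)
open import Data.Nat.GCD using (gcd; gcd[m,n]≢0)
open import Data.Product.Base using (∃; _×_; _,_; proj₁)
open import Data.Rational.Base as ℚ using (ℚ; Positive)
open import Data.Rational.Properties using (normalize-pos)
open import Data.Sum.Base using (_⊎_; inj₁)
open import Data.Vec.Base using (Vec; []; _∷_; map; zipWith; foldr′; transpose)
open import Function.Base using (flip)
open import Induction.WellFounded using (Acc)
open import Level using (0ℓ)
open import Relation.Binary.Bundles using (Setoid)
open import Relation.Binary.Construct.Closure.ReflexiveTransitive using (Star)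
import Relation.Binary.Construct.On as On
open import Relation.Binary.Core using (Rel)
open import Relation.Binary.PropositionalEquality using (_≡_; refl; setoid)
open import Relation.Unary using (Pred)

infixl 7 _·_ _/⁺_
infix  4 _⟶₁_ _⟶₂_

Matrix : ℕ → ℕ → Set
Matrix r c = Vec (Vec ℤ c) r

dot : ∀ {n} → Vec ℤ n → Vec ℤ n → ℤ
dot u v = foldr′ ℤ._+_ 0ℤ (zipWith ℤ._*_ u v)

_·_ : ∀ {r n c} → Matrix r n → Matrix n c → Matrix r c
A · B = map (λ row → map (dot row) (transpose B)) A

row : ℤ → ℤ → Matrix 1 2
row x y = (x ∷ y ∷ []) ∷ []

col : ℤ → ℤ → Matrix 2 1
col x y = (x ∷ []) ∷ (y ∷ []) ∷ []

𝐈 𝐋 𝐑 𝐋⁻¹ 𝐑⁻¹ : Matrix 2 2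
𝐈   = (1ℤ ∷ 0ℤ ∷ []) ∷ (0ℤ ∷ 1ℤ ∷ []) ∷ []
𝐋   = (1ℤ ∷ 0ℤ ∷ []) ∷ (1ℤ ∷ 1ℤ ∷ []) ∷ []
𝐑   = (1ℤ ∷ 1ℤ ∷ []) ∷ (0ℤ ∷ 1ℤ ∷ []) ∷ []
𝐋⁻¹ = (1ℤ ∷ 0ℤ ∷ []) ∷ (-1ℤ ∷ 1ℤ ∷ []) ∷ []
𝐑⁻¹ = (1ℤ ∷ -1ℤ ∷ []) ∷ (0ℤ ∷ 1ℤ ∷ []) ∷ []

𝐋-inverse : (𝐋 · 𝐋⁻¹ ≡ 𝐈) × (𝐋⁻¹ · 𝐋 ≡ 𝐈)
𝐋-inverse = refl , refl

𝐑-inverse : (𝐑 · 𝐑⁻¹ ≡ 𝐈) × (𝐑⁻¹ · 𝐑 ≡ 𝐈)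
𝐑-inverse = refl , refl

product : List (Matrix 2 2) → Matrix 2 2
product = List.foldr _·_ 𝐈

IsProductOf𝐋𝐑 : Pred (Matrix 2 2) 0ℓ
IsProductOf𝐋𝐑 D = ∃ λ As → All (λ A → A ≡ 𝐋 ⊎ A ≡ 𝐑) As × product As ≡ D

-- A subset is a Σ-type whose equality ignores the membership proof; in
-- particular two different factorisations of a matrix give the same element.
𝓜 : Setoid 0ℓ 0ℓ
𝓜 = On.setoid {B = ∃ IsProductOf𝐋𝐑} (setoid (Matrix 2 2)) proj₁

ℚ⁺ : Setoid 0ℓ 0ℓ
ℚ⁺ = On.setoid {B = ∃ Positive} (setoid ℚ) proj₁

_/⁺_ : (m n : ℕ) .{{_ : NonZero m}} .{{_ : NonZero n}} → Setoid.Carrier ℚ⁺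
m /⁺ n = (+ m) ℚ./ n , normalize-pos m n

instance
  gcd-nonZero : ∀ {m n} .{{_ : NonZero m}} → NonZero (gcd m n)
  gcd-nonZero {m} {n} = ℕ.≢-nonZero (gcd[m,n]≢0 m n (inj₁ (ℕ.≢-nonZero⁻¹ m)))

-- One pass through the body of each loop. The guards are exclusive and together
-- amount to the loop condition x ≢ y.
data _⟶₁_ : Rel (Matrix 1 2 × Matrix 2 2) 0ℓ where
  y<x : ∀ {x y D} → y < x → (row x y , D) ⟶₁ (row x y · 𝐋⁻¹ , 𝐋 · D)
  x<y : ∀ {x y D} → x < y → (row x y , D) ⟶₁ (row x y · 𝐑⁻¹ , 𝐑 · D)

data _⟶₂_ : Rel (Matrix 2 1 × Matrix 2 2) 0ℓ where
  y<x : ∀ {x y D} → y < x → (col x y , D) ⟶₂ (𝐑⁻¹ · col x y , D · 𝐑)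
  x<y : ∀ {x y D} → x < y → (col x y , D) ⟶₂ (𝐋⁻¹ · col x y , D · 𝐋)

-- No infinite run starts from s.
Terminates : {S : Set} → Rel S 0ℓ → S → Set
Terminates _⟶_ s = Acc (flip _⟶_) s

-- Started from v and D = 𝐈, the loop exits (x = y) with final matrix D.
FinalMatrix₁ : Matrix 1 2 → Matrix 2 2 → Set
FinalMatrix₁ v D = ∃ λ x → Star _⟶₁_ (v , 𝐈) (row x x , D)

FinalMatrix₂ : Matrix 2 1 → Matrix 2 2 → Set
FinalMatrix₂ v D = ∃ λ x → Star _⟶₂_ (v , 𝐈) (col x x , D)

{-# OPTIONS --safe #-}
module Submission where

open import Defs
open import Data.Fin.Base using (zero; suc)
open import Data.Integer.Base using (ℤ; +_; +[1+_]; 0ℤ; 1ℤ; -1ℤ; ∣_∣; +<+; _+_; _*_; _-_; -_; _<_)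
import Data.Integer.Properties as ℤ
open import Data.Integer.Tactic.RingSolver using (solve-∀)
open import Data.List.Base using ([]; _∷_; _++_)
open import Data.List.Relation.Unary.All using ([]; _∷_)
open import Data.List.Relation.Unary.All.Properties using (++⁺)
open import Data.Nat.Base as ℕ using (ℕ; suc; NonZero; _/_)
open import Data.Nat.Coprimality as Coprimality using (Coprime; coprime-/gcd)
open import Data.Nat.Divisibility using (_∣_; divides)
open import Data.Nat.DivMod using (m/n*n≡m)
open import Data.Nat.GCD using (gcd; gcd[m,n]∣m; gcd[m,n]∣n; m/gcd[m,n]≢0; n/gcd[m,n]≢0)
open import Data.Nat.Induction using (<-wellFounded)
import Data.Nat.Properties as ℕ
open import Data.Product.Base as Product using (Σ-syntax; ∃; ∃₂; _×_; _,_; proj₁; proj₂)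
open import Data.Rational.Base using (mkℚ; ↥_; ↧_)
open import Data.Rational.Properties using (↥-/; ↧-/; ↥p/↧p≡p; /-cong)
open import Data.Sum.Base using (_⊎_; inj₁; inj₂)
open import Data.Vec.Base using (Vec; []; _∷_; _⊛_; lookup; map; replicate; transpose)
open import Data.Vec.Properties
  using (lookup-map; lookup-replicate; lookup-⊛; map-cong; map-∘; map-id; tabulate∘lookup; tabulate-cong)
open import Data.Vec.Relation.Unary.All using (All; []; _∷_)
open import Function.Bundles using (Inverse; _⇔_; mk⇔; Equivalence)
import Function.Construct.Composition as Compose
open import Induction.WellFounded using (Acc; acc)
open import Level using (0ℓ)
open import Relation.Binary.Bundles using (Setoid)
open import Relation.Binary.Construct.Closure.ReflexiveTransitive using (Star; ε; _◅_; _◅◅_; gmap)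
open import Relation.Binary.Definitions using (tri<; tri≈; tri>)
open import Relation.Binary.PropositionalEquality
  using (_≡_; refl; sym; trans; cong; cong₂; subst; subst₂; module ≡-Reasoning)
open import Relation.Nullary.Negation using (contradiction)
open import Relation.Unary using (Pred)

-- The product v D of the current row with the accumulated matrix is a loop
-- invariant, so a run from (m n) exits at (k k) with (m n) = k (1 1) D, and k = 1
-- when m and n are coprime. Conversely, the loop on v D with v positive strips the
-- last factor of D at each pass (right multiplication by 𝐋 makes the first entry
-- the larger one, 𝐑 the second), so it recovers D from any multiple of (1 1) D.
-- Transposition exchanges 𝐋 with 𝐑 and turns one algorithm into the other.

-- Algebra of two-column integer matrices.

row-injective : ∀ {x y x′ y′} → row x y ≡ row x′ y′ → x ≡ x′ × y ≡ y′
row-injective refl = refl , refl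

·-assoc : ∀ {r} (A : Matrix r 2) (B C : Matrix 2 2) → (A · B) · C ≡ A · (B · C)
·-assoc A B C = trans (sym (map-∘ _ _ A)) (map-cong (lemma B C) A)
  where
  expand : ∀ x y a b c d e f →
    (x * a + (y * b + 0ℤ)) * e + ((x * c + (y * d + 0ℤ)) * f + 0ℤ)
    ≡ x * (a * e + (c * f + 0ℤ)) + (y * (b * e + (d * f + 0ℤ)) + 0ℤ)
  expand = solve-∀
  lemma : ∀ (B C : Matrix 2 2) u →
    map (dot (map (dot u) (transpose B))) (transpose C) ≡ map (dot u) (transpose (B · C))
  lemma ((a ∷ c ∷ []) ∷ (b ∷ d ∷ []) ∷ []) ((e ∷ g ∷ []) ∷ (f ∷ h ∷ []) ∷ []) (x ∷ y ∷ []) =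
    cong₂ (λ z w → z ∷ w ∷ []) (expand x y a b c d e f) (expand x y a b c d g h)

·-identityʳ : ∀ {r} (A : Matrix r 2) → A · 𝐈 ≡ A
·-identityʳ A = trans (map-cong lemma A) (map-id A)
  where
  expand₁ : ∀ x y → x * 1ℤ + (y * 0ℤ + 0ℤ) ≡ x
  expand₁ = solve-∀
  expand₂ : ∀ x y → x * 0ℤ + (y * 1ℤ + 0ℤ) ≡ y
  expand₂ = solve-∀
  lemma : ∀ u → map (dot u) (transpose 𝐈) ≡ u
  lemma (x ∷ y ∷ []) = cong₂ (λ z w → z ∷ w ∷ []) (expand₁ x y) (expand₂ x y)

·-identityˡ : (A : Matrix 2 2) → 𝐈 · A ≡ A
·-identityˡ ((a ∷ b ∷ []) ∷ (c ∷ d ∷ []) ∷ []) =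
  cong₂ (λ u v → u ∷ v ∷ [])
    (cong₂ (λ z w → z ∷ w ∷ []) (expand₁ a c) (expand₁ b d))
    (cong₂ (λ z w → z ∷ w ∷ []) (expand₂ a c) (expand₂ b d))
  where
  expand₁ : ∀ x y → 1ℤ * x + (0ℤ * y + 0ℤ) ≡ x
  expand₁ = solve-∀
  expand₂ : ∀ x y → 0ℤ * x + (1ℤ * y + 0ℤ) ≡ y
  expand₂ = solve-∀

-- Serves two purposes: a pass moves a generator from the row to the accumulated matrix without
-- changing their product, and a pass undoes right multiplication by a generator.
·-cancel-inner : ∀ {r} (A : Matrix r 2) (B C D : Matrix 2 2) → B · C ≡ 𝐈 → (A · B) · (C · D) ≡ A · D
·-cancel-inner A B C D BC≡𝐈 = begin
  (A · B) · (C · D) ≡⟨ ·-assoc A B (C · D) ⟩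
  A · (B · (C · D)) ≡⟨ cong (A ·_) (·-assoc B C D) ⟨
  A · ((B · C) · D) ≡⟨ cong (λ E → A · (E · D)) BC≡𝐈 ⟩
  A · (𝐈 · D)       ≡⟨ cong (A ·_) (·-identityˡ D) ⟩
  A · D             ∎
  where open ≡-Reasoning

-- Linearity in `k`. It relates an exit at `(k k)` to the normalised row `(1 1)`, and so fractions
-- in arbitrary terms to reduced ones.
row-scale : ∀ k D {p q} → row 1ℤ 1ℤ · D ≡ row p q → row k k · D ≡ row (k * p) (k * q)
row-scale k ((a ∷ b ∷ []) ∷ (c ∷ d ∷ []) ∷ []) refl = cong₂ row (expand k a c) (expand k b d)
  where
  expand : ∀ k x y → k * x + (k * y + 0ℤ) ≡ k * (1ℤ * x + (1ℤ * y + 0ℤ))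
  expand = solve-∀

-- Closure properties of the products of the generators.

IsGenerator : Pred (Matrix 2 2) 0ℓ
IsGenerator A = A ≡ 𝐋 ⊎ A ≡ 𝐑

𝐈-isProduct : IsProductOf𝐋𝐑 𝐈
𝐈-isProduct = [] , [] , refl

generator-·-isProduct : ∀ {A D} → IsGenerator A → IsProductOf𝐋𝐑 D → IsProductOf𝐋𝐑 (A · D)
generator-·-isProduct gA (As , gAs , refl) = _ ∷ As , gA ∷ gAs , refl

·-isProduct : ∀ {D E} → IsProductOf𝐋𝐑 D → IsProductOf𝐋𝐑 E → IsProductOf𝐋𝐑 (D · E)
·-isProduct (As , gAs , refl) (Bs , gBs , refl) = As ++ Bs , ++⁺ gAs gBs , product-++ As
  where
  product-++ : ∀ As → product (As ++ Bs) ≡ product As · product Bs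
  product-++ []       = sym (·-identityˡ (product Bs))
  product-++ (A ∷ As) = trans (cong (A ·_) (product-++ As)) (sym (·-assoc A (product As) (product Bs)))

-- Positive rows and the loop invariant.

PositiveRow : Pred (Matrix 1 2) 0ℓ
PositiveRow = All (All (0ℤ <_))

positiveRow : ∀ m n .{{_ : NonZero m}} .{{_ : NonZero n}} → PositiveRow (row (+ m) (+ n))
positiveRow m n = (+<+ (ℕ.>-nonZero⁻¹ m) ∷ +<+ (ℕ.>-nonZero⁻¹ n) ∷ []) ∷ []

0<1 : 0ℤ < 1ℤ
0<1 = +<+ ℕ.z<s

naturals : ∀ {v} → PositiveRow v →
           Σ[ p ∈ ℕ ] Σ[ q ∈ ℕ ] Σ[ _ ∈ NonZero p ] Σ[ _ ∈ NonZero q ] v ≡ row (+ p) (+ q)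
naturals ((+<+ 0<p ∷ +<+ 0<q ∷ []) ∷ []) = _ , _ , ℕ.>-nonZero 0<p , ℕ.>-nonZero 0<q , refl

row-𝐋 : ∀ x y → row x y · 𝐋 ≡ row (x + y) y
row-𝐋 x y = cong₂ row (expand₁ x y) (expand₂ x y)
  where
  expand₁ : ∀ x y → x * 1ℤ + (y * 1ℤ + 0ℤ) ≡ x + y
  expand₁ = solve-∀
  expand₂ : ∀ x y → x * 0ℤ + (y * 1ℤ + 0ℤ) ≡ y
  expand₂ = solve-∀

row-𝐑 : ∀ x y → row x y · 𝐑 ≡ row x (x + y)
row-𝐑 x y = cong₂ row (expand₁ x y) (expand₂ x y)
  where
  expand₁ : ∀ x y → x * 1ℤ + (y * 0ℤ + 0ℤ) ≡ x
  expand₁ = solve-∀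
  expand₂ : ∀ x y → x * 1ℤ + (y * 1ℤ + 0ℤ) ≡ x + y
  expand₂ = solve-∀

row-𝐋⁻¹ : ∀ x y → row x y · 𝐋⁻¹ ≡ row (x - y) y
row-𝐋⁻¹ x y = cong₂ row (expand₁ x y) (expand₂ x y)
  where
  expand₁ : ∀ x y → x * 1ℤ + (y * -1ℤ + 0ℤ) ≡ x - y
  expand₁ = solve-∀
  expand₂ : ∀ x y → x * 0ℤ + (y * 1ℤ + 0ℤ) ≡ y
  expand₂ = solve-∀

row-𝐑⁻¹ : ∀ x y → row x y · 𝐑⁻¹ ≡ row x (y - x)
row-𝐑⁻¹ x y = cong₂ row (expand₁ x y) (expand₂ x y)
  where
  expand₁ : ∀ x y → x * 1ℤ + (y * 0ℤ + 0ℤ) ≡ x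
  expand₁ = solve-∀
  expand₂ : ∀ x y → x * -1ℤ + (y * 1ℤ + 0ℤ) ≡ y - x
  expand₂ = solve-∀

i<j⇒0<j-i : ∀ {i j} → i < j → 0ℤ < j - i
i<j⇒0<j-i {i} {j} i<j = subst (_< j - i) (ℤ.+-inverseʳ i) (ℤ.+-monoˡ-< (- i) i<j)

i<i+j : ∀ i {j} → 0ℤ < j → i < i + j
i<i+j i 0<j = subst (_< i + _) (ℤ.+-identityʳ i) (ℤ.+-monoʳ-< i 0<j)

i<j+i : ∀ i {j} → 0ℤ < j → i < j + i
i<j+i i 0<j = subst (i <_) (ℤ.+-comm i _) (i<i+j i 0<j)

generator-positive : ∀ {v A} → PositiveRow v → IsGenerator A → PositiveRow (v · A)
generator-positive {(x ∷ y ∷ []) ∷ []} ((0<x ∷ 0<y ∷ []) ∷ []) (inj₁ refl) =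
  subst PositiveRow (sym (row-𝐋 x y)) ((ℤ.+-mono-< 0<x 0<y ∷ 0<y ∷ []) ∷ [])
generator-positive {(x ∷ y ∷ []) ∷ []} ((0<x ∷ 0<y ∷ []) ∷ []) (inj₂ refl) =
  subst PositiveRow (sym (row-𝐑 x y)) ((0<x ∷ ℤ.+-mono-< 0<x 0<y ∷ []) ∷ [])

product-positive : ∀ {v D} → PositiveRow v → IsProductOf𝐋𝐑 D → PositiveRow (v · D)
product-positive {v} 0<v ([] , [] , refl) = subst PositiveRow (sym (·-identityʳ v)) 0<v
product-positive {v} 0<v (A ∷ As , gA ∷ gAs , refl) =
  subst PositiveRow (·-assoc v A (product As)) (product-positive (generator-positive 0<v gA) (As , gAs , refl))

step-positive : ∀ {v D w E} → (v , D) ⟶₁ (w , E) → PositiveRow v → PositiveRow w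
step-positive (y<x {x} {y} lt) ((_ ∷ 0<y ∷ []) ∷ []) =
  subst PositiveRow (sym (row-𝐋⁻¹ x y)) ((i<j⇒0<j-i lt ∷ 0<y ∷ []) ∷ [])
step-positive (x<y {x} {y} lt) ((0<x ∷ _ ∷ []) ∷ []) =
  subst PositiveRow (sym (row-𝐑⁻¹ x y)) ((0<x ∷ i<j⇒0<j-i lt ∷ []) ∷ [])

-- Loop invariant of a run that starts from u with the identity matrix.
Invariant : Matrix 1 2 → Pred (Matrix 1 2 × Matrix 2 2) 0ℓ
Invariant u (v , D) = PositiveRow v × IsProductOf𝐋𝐑 D × v · D ≡ u

step-invariant : ∀ {u s t} → s ⟶₁ t → Invariant u s → Invariant u t
step-invariant s⟶t@(y<x {x} {y} {D} _) (0<v , pD , vD≡u) =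
  step-positive s⟶t 0<v , generator-·-isProduct (inj₁ refl) pD ,
  trans (·-cancel-inner (row x y) 𝐋⁻¹ 𝐋 D refl) vD≡u
step-invariant s⟶t@(x<y {x} {y} {D} _) (0<v , pD , vD≡u) =
  step-positive s⟶t 0<v , generator-·-isProduct (inj₂ refl) pD ,
  trans (·-cancel-inner (row x y) 𝐑⁻¹ 𝐑 D refl) vD≡u

run-invariant : ∀ {u s t} → Star _⟶₁_ s t → Invariant u s → Invariant u t
run-invariant ε          inv = inv
run-invariant (st ◅ sts) inv = run-invariant sts (step-invariant st inv)

-- Termination and determinism of the row algorithm.

entrySum : Matrix 1 2 → ℕ
entrySum ((x ∷ y ∷ []) ∷ []) = ∣ x + y ∣

∣-∣-mono-< : ∀ {i j} → 0ℤ < i → i < j → ∣ i ∣ ℕ.< ∣ j ∣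
∣-∣-mono-< (+<+ _) (+<+ i<j) = i<j

-- Subtracting the smaller entry leaves a row whose sum is the larger entry of the old row, and that
-- is less than the old sum because the smaller entry is positive.
step-entrySum : ∀ {v D w E} → (v , D) ⟶₁ (w , E) → PositiveRow v → entrySum w ℕ.< entrySum v
step-entrySum (y<x {x} {y} _) ((0<x ∷ 0<y ∷ []) ∷ []) =
  subst (λ w → entrySum w ℕ.< ∣ x + y ∣) (sym (row-𝐋⁻¹ x y))
    (subst (λ z → ∣ z ∣ ℕ.< ∣ x + y ∣) (x≡ x y) (∣-∣-mono-< 0<x (i<i+j x 0<y)))
  where
  x≡ : ∀ x y → x ≡ x - y + y
  x≡ = solve-∀
step-entrySum (x<y {x} {y} _) ((0<x ∷ 0<y ∷ []) ∷ []) =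
  subst (λ w → entrySum w ℕ.< ∣ x + y ∣) (sym (row-𝐑⁻¹ x y))
    (subst (λ z → ∣ z ∣ ℕ.< ∣ x + y ∣) (y≡ x y) (∣-∣-mono-< 0<y (i<j+i y 0<x)))
  where
  y≡ : ∀ x y → y ≡ x + (y - x)
  y≡ = solve-∀

terminates₁ : ∀ {v D} → PositiveRow v → Terminates _⟶₁_ (v , D)
terminates₁ {v} 0<v = go 0<v (<-wellFounded (entrySum v))
  where
  go : ∀ {v D} → PositiveRow v → Acc ℕ._<_ (entrySum v) → Terminates _⟶₁_ (v , D)
  go 0<v (acc rs) = acc λ st → go (step-positive st 0<v) (rs (step-entrySum st 0<v))

run-to-exit : ∀ {s} → Terminates _⟶₁_ s → ∃₂ λ x D → Star _⟶₁_ s (row x x , D)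
run-to-exit {(x ∷ y ∷ []) ∷ [] , D} (acc rs) with ℤ.<-cmp x y
... | tri≈ _ refl _ = x , D , ε
... | tri< lt _ _   = let z , E , run = run-to-exit (rs (x<y lt)) in z , E , x<y lt ◅ run
... | tri> _ _ gt   = let z , E , run = run-to-exit (rs (y<x gt)) in z , E , y<x gt ◅ run

-- The loop is deterministic: the two guards exclude each other, and at `row x x` either guard would
-- read `x < x`.
exit-unique : ∀ {s x D x′ D′} → Star _⟶₁_ s (row x x , D) → Star _⟶₁_ s (row x′ x′ , D′) → D ≡ D′
exit-unique ε ε = refl
exit-unique ε (y<x lt ◅ _) = contradiction lt (ℤ.<-irrefl refl)
exit-unique ε (x<y lt ◅ _) = contradiction lt (ℤ.<-irrefl refl)
exit-unique (y<x lt ◅ _) ε = contradiction lt (ℤ.<-irrefl refl)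
exit-unique (x<y lt ◅ _) ε = contradiction lt (ℤ.<-irrefl refl)
exit-unique (y<x _ ◅ run) (y<x _ ◅ run′) = exit-unique run run′
exit-unique (x<y _ ◅ run) (x<y _ ◅ run′) = exit-unique run run′
exit-unique (y<x lt ◅ _) (x<y gt ◅ _) = contradiction gt (ℤ.<-asym lt)
exit-unique (x<y lt ◅ _) (y<x gt ◅ _) = contradiction gt (ℤ.<-asym lt)

-- Recovering a product from its action on a positive row.

generator-step : ∀ {v A} D → PositiveRow v → IsGenerator A → (v · A , D) ⟶₁ (v , A · D)
generator-step {v@((x ∷ y ∷ []) ∷ [])} D ((0<x ∷ 0<y ∷ []) ∷ []) (inj₁ refl) =
  -- The constructor ends at `(v · 𝐋) · 𝐋⁻¹`. Taking `𝐈` as the fourth factor fits the cancellation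
  -- law, since the closed product `𝐋⁻¹ · 𝐈` computes to `𝐋⁻¹`.
  subst (λ w → (v · 𝐋 , D) ⟶₁ (w , 𝐋 · D))
    (trans (·-cancel-inner v 𝐋 𝐋⁻¹ 𝐈 refl) (·-identityʳ v)) (y<x guard)
  where
  guard = subst (λ { ((z ∷ w ∷ []) ∷ []) → w < z }) (sym (row-𝐋 x y)) (i<j+i y 0<x)
generator-step {v@((x ∷ y ∷ []) ∷ [])} D ((0<x ∷ 0<y ∷ []) ∷ []) (inj₂ refl) =
  subst (λ w → (v · 𝐑 , D) ⟶₁ (w , 𝐑 · D))
    (trans (·-cancel-inner v 𝐑 𝐑⁻¹ 𝐈 refl) (·-identityʳ v)) (x<y guard)
  where
  guard = subst (λ { ((z ∷ w ∷ []) ∷ []) → z < w }) (sym (row-𝐑 x y)) (i<i+j x 0<y)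

-- Induction on the factors with the head `A` absorbed into the row: from `v · A` times the tail,
-- the run strips the tail first and reaches `v · A`; one further pass then strips `A`.
product-run : ∀ {v D} E → PositiveRow v → IsProductOf𝐋𝐑 D → Star _⟶₁_ (v · D , E) (v , D · E)
product-run {v} E _ ([] , [] , refl) =
  subst₂ (λ w F → Star _⟶₁_ (w , E) (v , F)) (sym (·-identityʳ v)) (sym (·-identityˡ E)) ε
product-run {v} E 0<v (A ∷ As , gA ∷ gAs , refl) =
  subst₂ (λ w F → Star _⟶₁_ (w , E) (v , F)) (·-assoc v A (product As)) (sym (·-assoc A (product As) E))
    (product-run E (generator-positive 0<v gA) (As , gAs , refl)
      ◅◅ generator-step (product As · E) 0<v gA ◅ ε)

-- Scaled rows, coprime pairs and reduced fractions.

finalMatrix-product : ∀ {i D} → 0ℤ < i → IsProductOf𝐋𝐑 D → FinalMatrix₁ (row i i · D) D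
finalMatrix-product {i} {D} 0<i pD =
  i , subst (λ E → Star _⟶₁_ (row i i · D , 𝐈) (row i i , E)) (·-identityʳ D)
        (product-run {row i i} {D} 𝐈 ((0<i ∷ 0<i ∷ []) ∷ []) pD)

columnSums⇒finalMatrix : ∀ {D v} → IsProductOf𝐋𝐑 D → row 1ℤ 1ℤ · D ≡ v → FinalMatrix₁ v D
columnSums⇒finalMatrix {D} pD 𝟏D≡v =
  subst (λ v → FinalMatrix₁ v D) 𝟏D≡v (finalMatrix-product {1ℤ} {D} 0<1 pD)

-- The factor `k` stands on the right to match `↥-/` and `m/n*n≡m`, which supply the scaled entries
-- later.
finalMatrix-scaled : ∀ {D p q} k .{{_ : NonZero k}} → IsProductOf𝐋𝐑 D →
                     row 1ℤ 1ℤ · D ≡ row p q → FinalMatrix₁ (row (p * + k) (q * + k)) D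
finalMatrix-scaled {D} {p} {q} k pD 𝟏D≡ =
  subst (λ v → FinalMatrix₁ v D)
    (trans (row-scale (+ k) D 𝟏D≡) (cong₂ row (ℤ.*-comm (+ k) p) (ℤ.*-comm (+ k) q)))
    (finalMatrix-product (+<+ (ℕ.>-nonZero⁻¹ k)) pD)

finalMatrix-unique : ∀ {v D D′} → FinalMatrix₁ v D → FinalMatrix₁ v D′ → D ≡ D′
finalMatrix-unique (_ , run) (_ , run′) = exit-unique run run′

-- The matrix is found by running the loop. At the exit `(k k)` the invariant writes both `a` and
-- `b` as multiples of `k`, so coprimality forces `k` to be 1.
coprime-product : ∀ {a b} .{{_ : NonZero a}} .{{_ : NonZero b}} → Coprime a b →
                  ∃ λ D → IsProductOf𝐋𝐑 D × row 1ℤ 1ℤ · D ≡ row (+ a) (+ b)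
coprime-product {a} {b} coprime
  with run-to-exit (terminates₁ {D = 𝐈} (positiveRow a b))
... | x , D , run
  with run-invariant run (positiveRow a b , 𝐈-isProduct , ·-identityʳ (row (+ a) (+ b)))
-- Positivity of the exit row exposes its integer entry as a natural number `k`.
... | (+<+ {n = k} _ ∷ _ ∷ []) ∷ [] , pD , kD≡ = D , pD , trans (cong (λ i → row i i · D) (sym k≡1ℤ)) kD≡
  where
  module _ {p q} (𝟏D≡ : row 1ℤ 1ℤ · D ≡ row p q) where
    entries : + k * p ≡ + a × + k * q ≡ + b
    entries = row-injective (trans (sym (row-scale (+ k) D 𝟏D≡)) kD≡)
    divisor : ∀ {c} i → + k * i ≡ + c → k ∣ c
    divisor i eq = divides ∣ i ∣ (trans (cong ∣_∣ (sym eq)) (trans (ℤ.abs-* (+ k) i) (ℕ.*-comm k ∣ i ∣)))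
    k≡1 : k ≡ 1
    k≡1 = coprime (divisor p (proj₁ entries) , divisor q (proj₂ entries))
  k≡1ℤ : + k ≡ 1ℤ
  -- Splitting the product into its entries provides the `p` and `q` that the local module leaves
  -- abstract.
  k≡1ℤ with row 1ℤ 1ℤ · D in eq
  ... | (p ∷ q ∷ []) ∷ [] = cong +_ (k≡1 eq)

reducedProduct : (r : Setoid.Carrier ℚ⁺) →
                 ∃ λ D → IsProductOf𝐋𝐑 D × row 1ℤ 1ℤ · D ≡ row (↥ proj₁ r) (↧ proj₁ r)
-- The NonZero instances are explicit because instance search would also try
-- gcd-nonZero, and unifying a successor with an unfolding gcd diverges.
reducedProduct (mkℚ +[1+ a ] b coprime , _) =
  coprime-product {{ℕ.nonZero {a}}} {{ℕ.nonZero {b}}} (Coprimality.recompute coprime)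

-- The pair `(m n)` is the reduced form of the fraction scaled by the gcd, and scaling does not
-- change the final matrix. This makes the function on rationals well defined.
finalMatrix-reducedProduct : ∀ m n .{{_ : NonZero m}} .{{_ : NonZero n}} →
  FinalMatrix₁ (row (+ m) (+ n)) (proj₁ (reducedProduct (m /⁺ n)))
finalMatrix-reducedProduct m n =
  let D , pD , 𝟏D≡ = reducedProduct (m /⁺ n) in
  subst (λ v → FinalMatrix₁ v D) (cong₂ row (↥-/ (+ m) n) (↧-/ (+ m) n))
    (finalMatrix-scaled (gcd m n) pD 𝟏D≡)

-- Both matrices are final matrices of the run from the same row `v`.
product-injective : ∀ {D E v} → IsProductOf𝐋𝐑 D → IsProductOf𝐋𝐑 E →
                    row 1ℤ 1ℤ · D ≡ v → row 1ℤ 1ℤ · E ≡ v → D ≡ E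
product-injective pD pE 𝟏D≡v 𝟏E≡v =
  finalMatrix-unique (columnSums⇒finalMatrix pD 𝟏D≡v) (columnSums⇒finalMatrix pE 𝟏E≡v)

-- The bijection given by the row algorithm.

module ℚ⁺ = Setoid ℚ⁺
module 𝓜 = Setoid 𝓜

to₁ : ℚ⁺.Carrier → 𝓜.Carrier
to₁ r = let D , pD , _ = reducedProduct r in D , pD

-- Equality in `ℚ⁺` ignores the positivity proofs, on which `reducedProduct` could depend, so the
-- matrices are compared through their column sums.
to₁-cong : ∀ {r s} → r ℚ⁺.≈ s → to₁ r 𝓜.≈ to₁ s
to₁-cong {r} {s} r≈s =
  let _ , pD , 𝟏D≡ = reducedProduct r
      _ , pE , 𝟏E≡ = reducedProduct s
  in product-injective pD pE (trans 𝟏D≡ (cong (λ t → row (↥ t) (↧ t)) r≈s)) 𝟏E≡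

columnSums : (D : 𝓜.Carrier) →
  Σ[ p ∈ ℕ ] Σ[ q ∈ ℕ ] Σ[ _ ∈ NonZero p ] Σ[ _ ∈ NonZero q ] row 1ℤ 1ℤ · proj₁ D ≡ row (+ p) (+ q)
columnSums (D , pD) = naturals (product-positive ((0<1 ∷ 0<1 ∷ []) ∷ []) pD)

from₁ : 𝓜.Carrier → ℚ⁺.Carrier
from₁ D = let p , q , p≢0 , q≢0 , _ = columnSums D in (p /⁺ q) {{p≢0}} {{q≢0}}

from₁-cong : ∀ {D E} → D 𝓜.≈ E → from₁ D ℚ⁺.≈ from₁ E
from₁-cong {D} {E} D≈E =
  let _ , _ , _ , q≢0 , 𝟏D≡ = columnSums D
      _ , _ , _ , q′≢0 , 𝟏E≡ = columnSums E
      p≡p′ , q≡q′ = row-injective (trans (sym 𝟏D≡) (trans (cong (row 1ℤ 1ℤ ·_) D≈E) 𝟏E≡))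
  in /-cong {{q≢0}} {{q′≢0}} p≡p′ (ℤ.+-injective q≡q′)

-- The run from the column sums of `D` ends in `D`, and it also ends in the matrix chosen for their
-- quotient.
to₁∘from₁ : ∀ D → to₁ (from₁ D) 𝓜.≈ D
to₁∘from₁ (D , pD) =
  let p , q , p≢0 , q≢0 , 𝟏D≡ = columnSums (D , pD) in
  finalMatrix-unique (finalMatrix-reducedProduct p q {{p≢0}} {{q≢0}})
    (columnSums⇒finalMatrix pD 𝟏D≡)

from₁∘to₁ : ∀ r → from₁ (to₁ r) ℚ⁺.≈ r
from₁∘to₁ r =
  let _ , _ , 𝟏D≡ = reducedProduct r
      _ , _ , _ , q≢0 , 𝟏D≡′ = columnSums (to₁ r)
      p≡↥ , q≡↧ = row-injective (trans (sym 𝟏D≡′) 𝟏D≡)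
  in trans (/-cong {{q≢0}} {{ℕ.nonZero}} p≡↥ (ℤ.+-injective q≡↧)) (↥p/↧p≡p (proj₁ r))

φ₁ : Inverse ℚ⁺ 𝓜
φ₁ = record
  { to        = to₁
  ; from      = from₁
  ; to-cong   = λ {r} {s} → to₁-cong {r} {s}
  ; from-cong = λ {D} {E} → from₁-cong {D} {E}
  ; inverse   = (λ {D} {r} r≈ → trans (to₁-cong {r} {from₁ D} r≈) (to₁∘from₁ D))
              , (λ {r} {D} D≈ → trans (from₁-cong {D} {to₁ r} D≈) (from₁∘to₁ r))
  }

finalMatrix₁⇔ : ∀ m n .{{_ : NonZero m}} .{{_ : NonZero n}} D →
                FinalMatrix₁ (row (+ m) (+ n)) D ⇔ D ≡ proj₁ (to₁ (m /⁺ n))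
finalMatrix₁⇔ m n D = mk⇔
  (λ final → finalMatrix-unique final (finalMatrix-reducedProduct m n))
  (λ D≡ → subst (FinalMatrix₁ (row (+ m) (+ n))) (sym D≡) (finalMatrix-reducedProduct m n))

-- The quotients by the gcd are coprime, hence the column sums of some product `E`. Scaled back by
-- the gcd, they make `E` a final matrix for `(m n)` as well, so `D` equals `E`.
finalMatrix₁⇒columnSums : ∀ m n .{{_ : NonZero m}} .{{_ : NonZero n}} D → FinalMatrix₁ (row (+ m) (+ n)) D →
                          row 1ℤ 1ℤ · D ≡ row (+ (m / gcd m n)) (+ (n / gcd m n))
finalMatrix₁⇒columnSums m n D final =
  let E , pE , 𝟏E≡ = coprime-product {{ℕ.≢-nonZero (m/gcd[m,n]≢0 m n)}} {{ℕ.≢-nonZero (n/gcd[m,n]≢0 m n)}}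
                       (coprime-/gcd m n)
      final′ = subst (λ v → FinalMatrix₁ v E) (cong₂ row (cancel (gcd[m,n]∣m m n)) (cancel (gcd[m,n]∣n m n)))
                 (finalMatrix-scaled (gcd m n) pE 𝟏E≡)
  in trans (cong (row 1ℤ 1ℤ ·_) (finalMatrix-unique final final′)) 𝟏E≡
  where
  cancel : ∀ {i g} .{{_ : NonZero g}} → g ∣ i → + (i / g) * + g ≡ + i
  cancel {i} {g} g∣i = trans (sym (ℤ.pos-* (i / g) g)) (cong +_ (m/n*n≡m g∣i))

-- Transposition of matrices.

lookup-injective : ∀ {a n} {A : Set a} {xs ys : Vec A n} → (∀ i → lookup xs i ≡ lookup ys i) → xs ≡ ys
lookup-injective {xs = xs} {ys} eq =
  trans (sym (tabulate∘lookup xs)) (trans (tabulate-cong eq) (tabulate∘lookup ys))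

-- `transpose` is defined applicatively, by zipping the first row onto the transposed remainder with
-- `_∷_`; each `⊛` is evaluated at position `j`.
lookup-transpose-∷ : ∀ {a r c} {A : Set a} (u : Vec A c) (M : Vec (Vec A c) r) j →
                     lookup (transpose (u ∷ M)) j ≡ lookup u j ∷ lookup (transpose M) j
lookup-transpose-∷ {r = r} {c} {A} u M j = begin
  lookup (replicate c cons ⊛ u ⊛ transpose M) j
    ≡⟨ lookup-⊛ j (replicate c cons ⊛ u) (transpose M) ⟩
  lookup (replicate c cons ⊛ u) j (lookup (transpose M) j)
    ≡⟨ cong (λ f → f (lookup (transpose M) j)) (lookup-⊛ j (replicate c cons) u) ⟩
  lookup (replicate c cons) j (lookup u j) (lookup (transpose M) j)
    ≡⟨ cong (λ f → f (lookup u j) (lookup (transpose M) j)) (lookup-replicate j cons) ⟩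
  lookup u j ∷ lookup (transpose M) j ∎
  where
  open ≡-Reasoning
  -- `_∷_` is overloaded here; `cons` fixes the vector constructor and its length.
  cons : A → Vec A r → Vec A (suc r)
  cons = _∷_

lookup-transpose : ∀ {a r c} {A : Set a} (M : Vec (Vec A c) r) i j →
                   lookup (lookup (transpose M) j) i ≡ lookup (lookup M i) j
lookup-transpose (u ∷ M) zero    j = cong (λ v → lookup v zero) (lookup-transpose-∷ u M j)
lookup-transpose (u ∷ M) (suc i) j =
  trans (cong (λ v → lookup v (suc i)) (lookup-transpose-∷ u M j)) (lookup-transpose M i j)

transpose-involutive : ∀ {r c} (A : Matrix r c) → transpose (transpose A) ≡ A
transpose-involutive A = lookup-injective λ i → lookup-injective λ j →
  trans (lookup-transpose (transpose A) j i) (lookup-transpose A i j)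

dot-comm : ∀ {n} (u v : Vec ℤ n) → dot u v ≡ dot v u
dot-comm []      []      = refl
dot-comm (x ∷ u) (y ∷ v) = cong₂ _+_ (ℤ.*-comm x y) (dot-comm u v)

lookup-· : ∀ {r n c} (A : Matrix r n) (B : Matrix n c) i j →
           lookup (lookup (A · B) i) j ≡ dot (lookup A i) (lookup (transpose B) j)
lookup-· A B i j = trans (cong (λ u → lookup u j) (lookup-map i _ A)) (lookup-map j _ (transpose B))

transpose-· : ∀ {r n c} (A : Matrix r n) (B : Matrix n c) → transpose (A · B) ≡ transpose B · transpose A
transpose-· A B = lookup-injective λ j → lookup-injective λ i → begin
  lookup (lookup (transpose (A · B)) j) i
    ≡⟨ lookup-transpose (A · B) i j ⟩
  lookup (lookup (A · B) i) j
    ≡⟨ lookup-· A B i j ⟩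
  dot (lookup A i) (lookup (transpose B) j)
    ≡⟨ dot-comm (lookup A i) (lookup (transpose B) j) ⟩
  dot (lookup (transpose B) j) (lookup A i)
    -- `lookup-·` reads the second factor through its transpose, so `A` has to appear doubly
    -- transposed.
    ≡⟨ cong (λ M → dot (lookup (transpose B) j) (lookup M i)) (transpose-involutive A) ⟨
  dot (lookup (transpose B) j) (lookup (transpose (transpose A)) i)
    ≡⟨ lookup-· (transpose B) (transpose A) j i ⟨
  lookup (lookup (transpose B · transpose A) j) i ∎
  where open ≡-Reasoning

generator-transpose : ∀ {A} → IsGenerator A → IsGenerator (transpose A)
generator-transpose (inj₁ refl) = inj₂ refl
generator-transpose (inj₂ refl) = inj₁ refl

-- Transposition reverses the order of the factors, so the transposed head is appended on the right
-- as a product of one factor.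
transpose-isProduct : ∀ {D} → IsProductOf𝐋𝐑 D → IsProductOf𝐋𝐑 (transpose D)
transpose-isProduct ([] , [] , refl) = 𝐈-isProduct
transpose-isProduct (A ∷ As , gA ∷ gAs , refl) =
  subst IsProductOf𝐋𝐑 (sym (transpose-· A (product As)))
    (·-isProduct (transpose-isProduct (As , gAs , refl))
      (_ ∷ [] , generator-transpose gA ∷ [] , ·-identityʳ (transpose A)))

-- Transfer to the column algorithm.

transposeState : ∀ {r c} → Matrix r c × Matrix 2 2 → Matrix c r × Matrix 2 2
transposeState = Product.map transpose transpose

-- The guards are the same in both loops, and transposition carries `𝐑⁻¹` and `𝐑` to `𝐋⁻¹` and `𝐋`
-- while turning left factors into right ones.
step₂⇒step₁ : ∀ {s t} → s ⟶₂ t → transposeState s ⟶₁ transposeState t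
step₂⇒step₁ (y<x {x} {y} {D} lt) =
  subst₂ (λ v E → (row x y , transpose D) ⟶₁ (v , E))
    (sym (transpose-· 𝐑⁻¹ (col x y))) (sym (transpose-· D 𝐑))
    (y<x {D = transpose D} lt)
step₂⇒step₁ (x<y {x} {y} {D} lt) =
  subst₂ (λ v E → (row x y , transpose D) ⟶₁ (v , E))
    (sym (transpose-· 𝐋⁻¹ (col x y))) (sym (transpose-· D 𝐋))
    (x<y {D = transpose D} lt)

step₁⇒step₂ : ∀ {s t} → s ⟶₁ t → transposeState s ⟶₂ transposeState t
step₁⇒step₂ (y<x {x} {y} {D} lt) =
  subst₂ (λ v E → (col x y , transpose D) ⟶₂ (v , E))
    (sym (transpose-· (row x y) 𝐋⁻¹)) (sym (transpose-· 𝐋 D))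
    (y<x {D = transpose D} lt)
step₁⇒step₂ (x<y {x} {y} {D} lt) =
  subst₂ (λ v E → (col x y , transpose D) ⟶₂ (v , E))
    (sym (transpose-· (row x y) 𝐑⁻¹)) (sym (transpose-· 𝐑 D))
    (x<y {D = transpose D} lt)

-- Every pass of the column loop maps to a pass of the row loop, so accessibility pulls back along
-- transposition.
terminates₂ : ∀ {s} → Terminates _⟶₁_ (transposeState s) → Terminates _⟶₂_ s
terminates₂ (acc rs) = acc λ st → terminates₂ (rs (step₂⇒step₁ st))

finalMatrix₂⇒₁ : ∀ {x y D} → FinalMatrix₂ (col x y) D → FinalMatrix₁ (row x y) (transpose D)
finalMatrix₂⇒₁ (z , run) = z , gmap transposeState step₂⇒step₁ run

finalMatrix₁⇒₂ : ∀ {x y D} → FinalMatrix₁ (row x y) D → FinalMatrix₂ (col x y) (transpose D)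
finalMatrix₁⇒₂ (z , run) = z , gmap transposeState step₁⇒step₂ run

transpose-𝓜 : 𝓜.Carrier → 𝓜.Carrier
transpose-𝓜 (D , pD) = transpose D , transpose-isProduct pD

transposition : Inverse 𝓜 𝓜
transposition = record
  { to        = transpose-𝓜
  ; from      = transpose-𝓜
  ; to-cong   = cong transpose
  ; from-cong = cong transpose
  ; inverse   = (λ {D} E≈ → trans (cong transpose E≈) (transpose-involutive (proj₁ D)))
              , (λ {D} E≈ → trans (cong transpose E≈) (transpose-involutive (proj₁ D)))
  }

-- On the same fraction, the column algorithm ends in the transpose of the matrix that the row
-- algorithm ends in.
φ₂ : Inverse ℚ⁺ 𝓜
φ₂ = Compose.inverse φ₁ transposition

finalMatrix₂⇔ : ∀ m n .{{_ : NonZero m}} .{{_ : NonZero n}} D →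
                FinalMatrix₂ (col (+ m) (+ n)) D ⇔ D ≡ transpose (proj₁ (to₁ (m /⁺ n)))
finalMatrix₂⇔ m n D = mk⇔
  (λ final → trans (sym (transpose-involutive D))
    (cong transpose (Equivalence.to (finalMatrix₁⇔ m n (transpose D)) (finalMatrix₂⇒₁ final))))
  (λ D≡ → subst (FinalMatrix₂ (col (+ m) (+ n))) (sym D≡)
    (finalMatrix₁⇒₂ (finalMatrix-reducedProduct m n)))

rowSums : ∀ D {p q} → row 1ℤ 1ℤ · transpose D ≡ row p q → D · col 1ℤ 1ℤ ≡ col p q
rowSums D 𝟏Dᵀ≡ = begin
  D · col 1ℤ 1ℤ                         ≡⟨ transpose-involutive (D · col 1ℤ 1ℤ) ⟨
  transpose (transpose (D · col 1ℤ 1ℤ)) ≡⟨ cong transpose (transpose-· D (col 1ℤ 1ℤ)) ⟩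
  transpose (row 1ℤ 1ℤ · transpose D)   ≡⟨ cong transpose 𝟏Dᵀ≡ ⟩
  transpose (row _ _)                   ∎
  where open ≡-Reasoning

theorem31 : ( (∀ (m n : ℕ) .{{_ : NonZero m}} .{{_ : NonZero n}} →
    Terminates _⟶₁_ (row (+ m) (+ n) , 𝐈))
    × (Σ[ φ ∈ Inverse ℚ⁺ 𝓜 ]
    (∀ (m n : ℕ) .{{_ : NonZero m}} .{{_ : NonZero n}} D →
    FinalMatrix₁ (row (+ m) (+ n)) D ⇔ D ≡ proj₁ (Inverse.to φ (m /⁺ n)))
    × (∀ (D : Setoid.Carrier 𝓜) →
    Σ[ p ∈ ℕ ] Σ[ q ∈ ℕ ] Σ[ p≢0 ∈ NonZero p ] Σ[ q≢0 ∈ NonZero q ]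
    row 1ℤ 1ℤ · proj₁ D ≡ row (+ p) (+ q)
    × Setoid._≈_ ℚ⁺ (Inverse.from φ D) ((p /⁺ q) {{p≢0}} {{q≢0}})))
    × (∀ (m n : ℕ) .{{_ : NonZero m}} .{{_ : NonZero n}} D →
    FinalMatrix₁ (row (+ m) (+ n)) D →
    row 1ℤ 1ℤ · D ≡ row (+ (m / gcd m n)) (+ (n / gcd m n))) )
    ×
    ( (∀ (m n : ℕ) .{{_ : NonZero m}} .{{_ : NonZero n}} →
    Terminates _⟶₂_ (col (+ m) (+ n) , 𝐈))
    × (Σ[ φ ∈ Inverse ℚ⁺ 𝓜 ]
    (∀ (m n : ℕ) .{{_ : NonZero m}} .{{_ : NonZero n}} D →
    FinalMatrix₂ (col (+ m) (+ n)) D ⇔ D ≡ proj₁ (Inverse.to φ (m /⁺ n)))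
    × (∀ (D : Setoid.Carrier 𝓜) →
    Σ[ p ∈ ℕ ] Σ[ q ∈ ℕ ] Σ[ p≢0 ∈ NonZero p ] Σ[ q≢0 ∈ NonZero q ]
    proj₁ D · col 1ℤ 1ℤ ≡ col (+ p) (+ q)
    × Setoid._≈_ ℚ⁺ (Inverse.from φ D) ((p /⁺ q) {{p≢0}} {{q≢0}}))) )
theorem31 =
  ( (λ m n → terminates₁ (positiveRow m n))
  , (φ₁ , finalMatrix₁⇔
    , λ D → let p , q , p≢0 , q≢0 , 𝟏D≡ = columnSums D in p , q , p≢0 , q≢0 , 𝟏D≡ , refl)
  , finalMatrix₁⇒columnSums )
  ,
  ( (λ m n → terminates₂ (terminates₁ (positiveRow m n)))
  , (φ₂ , finalMatrix₂⇔
    -- The inverse of `φ₂` transposes and then applies `from₁`, so the witnesses are the column sums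
    -- of the transpose, that is, the row sums of `D`, and the last component holds by `refl`.
    , λ D → let p , q , p≢0 , q≢0 , 𝟏Dᵀ≡ = columnSums (transpose-𝓜 D)
            in p , q , p≢0 , q≢0 , rowSums (proj₁ D) 𝟏Dᵀ≡ , refl) )
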